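{- Let $G$ be any graph of order $n$. If $H$ is any graph with root $v\in V(H)$, then $$\nu_I(G\circ_v H)\in\bigl\{\,n\,\nu_I(H)-\beta(G),\ \ n\,\nu_I(H),\ \ n\,\nu_I(H)+\nu_I(G)\,\bigr\}.$$
   Context: All graphs are finite and simple; the order of a graph is its number of vertices. A matching $M$ of a graph $G$ is an induced matching if no two distinct edges of $M$ are joined by an edge of $G$; $\nu_I(G)$ denotes the maximum cardinality of an induced matching in $G$. $\beta(G)$ is the vertex cover number of $G$. For a graph $G$ with $V(G)=\{v_1,\ldots,v_n\}$ and a graph $H$ with a distinguished vertex (root) $v$, the rooted product $G\circ_v H$ has vertex set $V(G)\times V(H)$ and edge set $$\bigcup_{i=1}^{n}\{(v_i,h)(v_i,h')\mid hh'\in E(H)\}\ \cup\ \{(v_i,v)(v_j,v)\mid v_iv_j\in E(G)\}.$$ -}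

module Defs where

open import Data.Fin using (Fin; zero; suc)
import Data.Fin.Properties as Fin
open import Data.Fin.Subset using (Subset; ∣_∣; ⊤) renaming (_∈_ to _∈ₛ_)
open import Data.Fin.Subset.Properties using (_∈?_; ∈⊤; ∣⊤∣≡n; anySubset?)
open import Data.List using (List; []; _∷_; length; map; lookup)
open import Data.List.Membership.Propositional.Properties using (∈-lookup)
open import Data.List.Properties using (length-map)
open import Data.List.Relation.Unary.All using (All; []; all?)
import Data.List.Relation.Unary.All as All
open import Data.List.Relation.Unary.AllPairs using (AllPairs; []; _∷_; allPairs?)
import Data.List.Relation.Unary.AllPairs as AllPairs
import Data.List.Relation.Unary.AllPairs.Properties as AllPairs
open import Data.List.Relation.Unary.Unique.Propositional using (Unique)
open import Data.Nat using (ℕ; zero; suc; _*_; _≤_; z≤n; s≤s; s≤s⁻¹)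
import Data.Nat.Properties as ℕ
open import Data.Product using (_×_; _,_; ∃; proj₁)
open import Data.Product.Function.NonDependent.Propositional using (_×-↔_)
open import Data.Sum using (_⊎_; inj₁; inj₂)
open import Function using (_↔_; _∘_; Inverse; Injection)
open import Function.Definitions using (Injective)
open import Function.Construct.Composition using (_↔-∘_)
open import Function.Construct.Symmetry using (↔-sym)
open import Function.Properties.Inverse using (↔⇒↣)
open import Level using (0ℓ)
open import Relation.Binary using (Rel; Symmetric; Irreflexive; DecidableEquality)
import Relation.Binary as B
open import Relation.Binary.PropositionalEquality using (_≡_; refl; sym; cong; subst)
open import Relation.Nullary using (Dec; yes; no; ¬_; ¬?; contradiction)
open import Relation.Nullary.Decidable using (map′; via-injection; _×-dec_; _⊎-dec_; _→-dec_)
open import Relation.Unary using (Pred; Decidable)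

record Graph : Set₁ where
  infix 4 _~_ _~?_ _≟_
  field
    V           : Set
    order       : ℕ
    enumeration : V ↔ Fin order
    _~_         : Rel V 0ℓ
    _~?_        : B.Decidable _~_
    ~-sym       : Symmetric _~_
    ~-irrefl    : Irreflexive _≡_ _~_

  index : V → Fin order
  index = Inverse.to enumeration

  vertex : Fin order → V
  vertex = Inverse.from enumeration

  vertex-index : ∀ x → vertex (index x) ≡ x
  vertex-index = Inverse.strictlyInverseʳ enumeration

  index-injective : ∀ {x y} → index x ≡ index y → x ≡ y
  index-injective = Injection.injective (↔⇒↣ enumeration)

  _≟_ : DecidableEquality V
  _≟_ = via-injection (↔⇒↣ enumeration) Fin._≟_

  any? : ∀ {P : Pred V 0ℓ} → Decidable P → Dec (∃ P)
  any? {P} P? = map′ (λ (i , p) → vertex i , p)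
                     (λ (x , p) → index x , subst P (sym (vertex-index x)) p)
                     (Fin.any? (P? ∘ vertex))

  all-vertices? : ∀ {P : Pred V 0ℓ} → Decidable P → Dec (∀ x → P x)
  all-vertices? {P} P? = map′ (λ f x → subst P (vertex-index x) (f (index x)))
                              (λ f i → f (vertex i))
                              (Fin.all? (P? ∘ vertex))

IsMaximum : Pred ℕ 0ℓ → Pred ℕ 0ℓ
IsMaximum P k = P k × (∀ {j} → P j → j ≤ k)

IsMinimum : Pred ℕ 0ℓ → Pred ℕ 0ℓ
IsMinimum P k = P k × (∀ {j} → P j → k ≤ j)

maximum : ∀ {P : Pred ℕ 0ℓ} → Decidable P → P 0 →
          ∀ b → (∀ {k} → P k → k ≤ b) → ∃ (IsMaximum P)
maximum P? p₀ zero    bound = 0 , p₀ , bound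
maximum {P} P? p₀ (suc b) bound with P? (suc b)
... | yes p = suc b , p , bound
... | no ¬p = maximum P? p₀ b λ q →
  s≤s⁻¹ (ℕ.≤∧≢⇒< (bound q) (λ eq → ¬p (subst P eq q)))

minimum : ∀ {P : Pred ℕ 0ℓ} → Decidable P → ∀ n → P n → ∃ (IsMinimum P)
minimum P? n p with P? 0
minimum P? n p | yes p₀ = 0 , p₀ , λ _ → z≤n
minimum P? zero p | no ¬p₀ = contradiction p ¬p₀
minimum {P} P? (suc n) p | no ¬p₀ with minimum {P ∘ suc} (P? ∘ suc) n p
... | k , pₖ , least = suc k , pₖ , least′
  where
  least′ : ∀ {j} → P j → suc k ≤ j
  least′ {zero}  q = contradiction q ¬p₀
  least′ {suc j} q = s≤s (least q)

lookup-injective : ∀ {A : Set} {xs : List A} → Unique xs →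
                   Injective _≡_ _≡_ (lookup xs)
lookup-injective (_   ∷ _) {zero}  {zero}  _  = refl
lookup-injective (x∉ ∷ _) {zero}  {suc j} eq =
  contradiction eq (All.lookup x∉ (∈-lookup j))
lookup-injective (x∉ ∷ _) {suc i} {zero}  eq =
  contradiction (sym eq) (All.lookup x∉ (∈-lookup i))
lookup-injective (_   ∷ u) {suc i} {suc j} eq = cong suc (lookup-injective u eq)

module _ (G : Graph) where
  open Graph G

  -- An edge is given by its two ends in either order.  The two orderings of an
  -- edge share a vertex, so a matching lists each of its edges exactly once and
  -- its cardinality is the length of the list.

  EndsRelated : Rel V 0ℓ → Rel (V × V) 0ℓ
  EndsRelated R (a , b) (c , d) = (R a c ⊎ R a d) ⊎ (R b c ⊎ R b d)

  IsEdge : Pred (V × V) 0ℓ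
  IsEdge (a , b) = a ~ b

  ShareVertex JoinedByEdge : Rel (V × V) 0ℓ
  ShareVertex  = EndsRelated _≡_
  JoinedByEdge = EndsRelated _~_

  IsMatching : Pred (List (V × V)) 0ℓ
  IsMatching M = All IsEdge M × AllPairs (λ e f → ¬ ShareVertex e f) M

  IsInducedMatching : Pred (List (V × V)) 0ℓ
  IsInducedMatching M = IsMatching M × AllPairs (λ e f → ¬ JoinedByEdge e f) M

  HasInducedMatchingOfSize : Pred ℕ 0ℓ
  HasInducedMatchingOfSize k = ∃ λ M → IsInducedMatching M × length M ≡ k

  IsVertexCover : Pred (Subset order) 0ℓ
  IsVertexCover C = ∀ x y → x ~ y → index x ∈ₛ C ⊎ index y ∈ₛ C

  HasVertexCoverOfSize : Pred ℕ 0ℓ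
  HasVertexCoverOfSize k = ∃ λ C → IsVertexCover C × ∣ C ∣ ≡ k

  endsRelated? : ∀ {R} → B.Decidable R → B.Decidable (EndsRelated R)
  endsRelated? R? (a , b) (c , d) =
    (R? a c ⊎-dec R? a d) ⊎-dec (R? b c ⊎-dec R? b d)

  isInducedMatching? : Decidable IsInducedMatching
  isInducedMatching? M =
    (all? (λ (a , b) → a ~? b) M ×-dec
     allPairs? (λ e f → ¬? (endsRelated? _≟_ e f)) M) ×-dec
    allPairs? (λ e f → ¬? (endsRelated? _~?_ e f)) M

  anyListOfLength? : ∀ {P : Pred (List (V × V)) 0ℓ} → Decidable P →
                     ∀ k → Dec (∃ λ M → P M × length M ≡ k)
  anyListOfLength? P? zero =
    map′ (λ p → [] , p , refl) (λ { ([] , p , refl) → p }) (P? [])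
  anyListOfLength? P? (suc k) =
    map′ (λ (a , b , M , p , eq) → (a , b) ∷ M , p , cong suc eq)
         (λ { ((a , b) ∷ M , p , refl) → a , b , M , p , refl })
         (any? λ a → any? λ b → anyListOfLength? (P? ∘ ((a , b) ∷_)) k)

  inducedMatching-length≤order : ∀ {M} → IsInducedMatching M → length M ≤ order
  inducedMatching-length≤order {M} ((_ , disjoint) , _) =
    subst (_≤ order) (length-map proj₁ M)
      (Fin.injective⇒≤ {f = index ∘ lookup (map proj₁ M)}
        (λ eq → lookup-injective unique (index-injective eq)))
    where
    unique = AllPairs.map⁺ (AllPairs.map (λ ¬s eq → ¬s (inj₁ (inj₁ eq))) disjoint)

  maximumInducedMatching : ∃ (IsMaximum HasInducedMatchingOfSize)
  maximumInducedMatching =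
    maximum (anyListOfLength? isInducedMatching?)
            ([] , (([] , []) , []) , refl)
            order
            (λ { (M , ind , refl) → inducedMatching-length≤order ind })

  isVertexCover? : Decidable IsVertexCover
  isVertexCover? C =
    all-vertices? λ x → all-vertices? λ y →
      (x ~? y) →-dec ((index x ∈? C) ⊎-dec (index y ∈? C))

  minimumVertexCover : ∃ (IsMinimum HasVertexCoverOfSize)
  minimumVertexCover =
    minimum (λ k → anySubset? (λ C → isVertexCover? C ×-dec (∣ C ∣ ℕ.≟ k)))
            order
            (⊤ , (λ _ _ _ → inj₁ ∈⊤) , ∣⊤∣≡n order)

  νᴵ : ℕ
  νᴵ = proj₁ maximumInducedMatching

  β : ℕ
  β = proj₁ minimumVertexCover

rootedProduct : (G H : Graph) → Graph.V H → Graph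
rootedProduct G H v = record
  { V           = G.V × H.V
  ; order       = G.order * H.order
  ; enumeration = ↔-sym Fin.*↔× ↔-∘ (G.enumeration ×-↔ H.enumeration)
  ; _~_         = _~_
  ; _~?_        = λ (x , h) (x′ , h′) →
                    ((x G.≟ x′) ×-dec (h H.~? h′)) ⊎-dec
                    ((x G.~? x′) ×-dec ((h H.≟ v) ×-dec (h′ H.≟ v)))
  ; ~-sym       = λ where
      (inj₁ (eq , e))       → inj₁ (sym eq , H.~-sym e)
      (inj₂ (e , eq , eq′)) → inj₂ (G.~-sym e , eq′ , eq)
  ; ~-irrefl    = λ where
      refl (inj₁ (_ , e)) → H.~-irrefl refl e
      refl (inj₂ (e , _)) → G.~-irrefl refl e
  }
  where
  module G = Graph G
  module H = Graph H
  _~_ : Rel (G.V × H.V) 0ℓ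
  (x , h) ~ (x′ , h′) = (x ≡ x′ × h H.~ h′) ⊎ (x G.~ x′ × h ≡ v × h′ ≡ v)

{-# OPTIONS --safe #-}

-- Fix a maximum induced matching M of the product and group its edges by the copy
-- of H containing their first end; write a = νᴵ H,
-- and call an induced matching with a edges an a-matching.
--   * If some a-matching of H avoids the closed neighbourhood of v, then using it in
--     every copy leaves the roots free for an induced matching of G; conversely the
--     edges of M inside the copies number at most n * a, the others at most νᴵ G.
--   * Otherwise every group has at most a edges, because an edge at the root of a copy
--     keeps the rest of the group off the closed neighbourhood of v.  If some a-matching
--     avoids v, then n * a is attained.
--   * If every a-matching covers v, then every group with a edges covers its root, so the
--     groups with fewer than a edges form a vertex cover of G.  Conversely, given a
--     cover, use an a-matching in the copies off it and delete the edge at v in the others.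
module Submission where

open import Defs
open import Data.Bool using (Bool; true; false; if_then_else_)
open import Data.Fin using (Fin; zero; suc)
import Data.Fin.Properties as Fin
open import Data.Fin.Subset using (Subset; ∣_∣) renaming (_∈_ to _∈ₛ_)
open import Data.Integer using (+_; _-_)
import Data.Integer as ℤ
import Data.Integer.Properties as ℤ
open import Data.List using (List; []; _∷_; _++_; concat; filter; length; map; tabulate)
open import Data.List.Membership.Propositional using (_∈_; find; lose)
open import Data.List.Membership.Propositional.Properties using (∈-filter⁻; ∈-map⁺)
open import Data.List.Properties using (filter-all; length-++; length-map)
open import Data.List.Relation.Unary.All using (All; []; _∷_; all?)
import Data.List.Relation.Unary.All as All
import Data.List.Relation.Unary.All.Properties as All
open import Data.List.Relation.Unary.AllPairs using (AllPairs; []; _∷_)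
import Data.List.Relation.Unary.AllPairs as AllPairs
import Data.List.Relation.Unary.AllPairs.Properties as AllPairs
open import Data.List.Relation.Unary.Any using (Any; here; there; any?)
import Data.Vec as Vec
open import Data.Vec.Properties using ([]=⇒lookup; lookup⇒[]=; lookup∘tabulate)
open import Data.Nat using (ℕ; zero; suc; _+_; _*_; _≤_; _<_; z≤n; s≤s)
import Data.Nat.Properties as ℕ
open import Data.Product using (_×_; _,_; ∃; ∃₂; proj₁; proj₂)
open import Data.Sum using (_⊎_; inj₁; inj₂)
import Data.Sum as Sum
open import Function using (_∘_; Inverse)
open import Function.Definitions using (Injective)
open import Level using (0ℓ)
open import Relation.Binary using (Rel; Symmetric)
open import Relation.Binary.PropositionalEquality
  using (_≡_; _≢_; refl; sym; trans; cong; cong₂; subst; subst₂; module ≡-Reasoning)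
open import Relation.Nullary using (Dec; yes; no; ¬_; ¬?; does; contradiction)
open import Relation.Nullary.Decidable using (_×-dec_; _⊎-dec_; dec-true)
open import Relation.Unary using (Pred; Decidable; ∁)

open import Algebra.Properties.CommutativeMonoid.Sum ℕ.+-0-commutativeMonoid
  using (sum; sum-cong-≗; ∑-distrib-+)

private
  variable
    A B : Set
    m n : ℕ

-- Finite sums of naturals and indicator counts.

sum-mono-≤ : {f g : Fin n → ℕ} → (∀ i → f i ≤ g i) → sum f ≤ sum g
sum-mono-≤ {zero}  f≤g = z≤n
sum-mono-≤ {suc n} f≤g = ℕ.+-mono-≤ (f≤g zero) (sum-mono-≤ (f≤g ∘ suc))

sum-mono-< : {f g : Fin n → ℕ} → (∀ i → f i ≤ g i) → ∀ j → f j < g j → sum f < sum g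
sum-mono-< f≤g zero    f<g = ℕ.+-mono-<-≤ f<g (sum-mono-≤ (f≤g ∘ suc))
sum-mono-< f≤g (suc j) f<g = ℕ.+-mono-≤-< (f≤g zero) (sum-mono-< (f≤g ∘ suc) j f<g)

sum-const : ∀ n m → sum {n} (λ _ → m) ≡ n * m
sum-const zero    m = refl
sum-const (suc n) m = cong (_+_ m) (sum-const n m)

sum≤n*m : {f : Fin n → ℕ} → (∀ i → f i ≤ m) → sum f ≤ n * m
sum≤n*m {n} {m} {f} f≤m = subst (sum f ≤_) (sum-const n m) (sum-mono-≤ f≤m)

n*m≤sum : {f : Fin n → ℕ} → (∀ i → m ≤ f i) → n * m ≤ sum f
n*m≤sum {n} {m} {f} m≤f = subst (_≤ sum f) (sum-const n m) (sum-mono-≤ m≤f)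

indicator : Bool → ℕ
indicator b = if b then 1 else 0

-- The indicator is 1 only where there is room for it. Summed over copies, this trades a missing
-- edge for a vertex of the cover.
+-indicator-≤ : (m<n? : Dec (m < n)) → m ≤ n → m + indicator (does m<n?) ≤ n
+-indicator-≤ {m} (yes m<n) _   = ℕ.≤-trans (ℕ.≤-reflexive (ℕ.+-comm m 1)) m<n
+-indicator-≤ {m} (no _)    m≤n = ℕ.≤-trans (ℕ.≤-reflexive (ℕ.+-identityʳ m)) m≤n

∣∣≡sum-indicator : (C : Subset n) → ∣ C ∣ ≡ sum (indicator ∘ Vec.lookup C)
∣∣≡sum-indicator Vec.[]          = refl
∣∣≡sum-indicator (true Vec.∷ C)  = cong suc (∣∣≡sum-indicator C)
∣∣≡sum-indicator (false Vec.∷ C) = ∣∣≡sum-indicator C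

length-concat-tabulate : (F : Fin n → List A) →
                         length (concat (tabulate F)) ≡ sum (length ∘ F)
length-concat-tabulate {zero}  F = refl
length-concat-tabulate {suc n} F =
  trans (length-++ (F zero)) (cong (_+_ _) (length-concat-tabulate (F ∘ suc)))

-- Fibres, filters and pairwise relations on lists.

fibre : (A → Fin n) → Fin n → List A → List A
fibre g i = filter (λ x → g x Fin.≟ i)

-- Prepending `x` shortens no fibre and strictly lengthens the one over `g x`.
length≤sum-fibres : (g : A → Fin n) (xs : List A) →
                    length xs ≤ sum (λ i → length (fibre g i xs))
length≤sum-fibres g []       = z≤n
length≤sum-fibres g (x ∷ xs) =
  ℕ.≤-trans (s≤s (length≤sum-fibres g xs)) (sum-mono-< grows (g x) grows-at)
  where
  grows : ∀ i → length (fibre g i xs) ≤ length (fibre g i (x ∷ xs))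
  grows i with g x Fin.≟ i
  ... | yes _ = ℕ.n≤1+n _
  ... | no  _ = ℕ.≤-refl
  grows-at : length (fibre g (g x) xs) < length (fibre g (g x) (x ∷ xs))
  grows-at with g x Fin.≟ g x
  ... | yes _ = ℕ.≤-refl
  ... | no ¬p = contradiction refl ¬p

length-filter+filter-∁ : {P : Pred A 0ℓ} (P? : Decidable P) (xs : List A) →
  length xs ≡ length (filter P? xs) + length (filter (¬? ∘ P?) xs)
length-filter+filter-∁ P? []       = refl
length-filter+filter-∁ P? (x ∷ xs) with P? x
... | yes _ = cong suc (length-filter+filter-∁ P? xs)
... | no  _ = trans (cong suc (length-filter+filter-∁ P? xs)) (sym (ℕ.+-suc _ _))

-- At the first element satisfying `P`, `clash` excludes `P` from the rest of the list, so the
-- filter keeps the whole tail.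
length≤1+filter-∁ : {P : Pred A 0ℓ} {R : Rel A 0ℓ} (P? : Decidable P) →
  (∀ {x y} → P x → P y → ¬ R x y) → ∀ {xs} → AllPairs R xs →
  length xs ≤ suc (length (filter (¬? ∘ P?) xs))
length≤1+filter-∁ P? clash []              = z≤n
length≤1+filter-∁ P? clash {x ∷ xs} (r ∷ rs) with P? x
... | no _  = s≤s (length≤1+filter-∁ P? clash rs)
... | yes p = s≤s (ℕ.≤-reflexive (sym (cong length
                (filter-all (¬? ∘ P?) (All.map (λ r q → clash p q r) r)))))

allPairs-lookup : {R : Rel A 0ℓ} → Symmetric R → ∀ {xs} → AllPairs R xs →
                  ∀ {x y} → x ∈ xs → y ∈ xs → x ≢ y → R x y
allPairs-lookup R-sym (r ∷ rs) (here refl) (here refl) x≢y = contradiction refl x≢y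
allPairs-lookup R-sym (r ∷ rs) (here refl) (there y∈)  x≢y = All.lookup r y∈
allPairs-lookup R-sym (r ∷ rs) (there x∈)  (here refl) x≢y = R-sym (All.lookup r x∈)
allPairs-lookup R-sym (r ∷ rs) (there x∈)  (there y∈)  x≢y =
  allPairs-lookup R-sym rs x∈ y∈ x≢y

-- Presents a list as a literal `map`, the form that `induced⁻` can pull back.
all-image : {f : A → B} {ys : List B} → All (λ y → ∃ λ x → y ≡ f x) ys →
            ∃ λ xs → ys ≡ map f xs
all-image []             = [] , refl
all-image ((x , eq) ∷ p) = let xs , eqs = all-image p in x ∷ xs , cong₂ _∷_ eq eqs

-- Ends of edges and induced matchings.

_EndOf_ : A → A × A → Set
x EndOf (a , b) = x ≡ a ⊎ x ≡ b

module _ (G : Graph) where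
  open Graph G

  endOf? : ∀ x → Decidable (x EndOf_)
  endOf? x (a , b) = (x ≟ a) ⊎-dec (x ≟ b)

  -- With its converse `relatedEnds`, this replaces the four-way disjunction of `EndsRelated` by
  -- quantification over ends, so later arguments need not split on orientation.
  relate : (R : Rel V 0ℓ) → ∀ {x y e f} →
           x EndOf e → y EndOf f → R x y → EndsRelated G R e f
  relate R (inj₁ refl) (inj₁ refl) r = inj₁ (inj₁ r)
  relate R (inj₁ refl) (inj₂ refl) r = inj₁ (inj₂ r)
  relate R (inj₂ refl) (inj₁ refl) r = inj₂ (inj₁ r)
  relate R (inj₂ refl) (inj₂ refl) r = inj₂ (inj₂ r)

  relatedEnds : (R : Rel V 0ℓ) → ∀ {e f} → EndsRelated G R e f →
                ∃₂ λ x y → x EndOf e × y EndOf f × R x y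
  relatedEnds R (inj₁ (inj₁ r)) = _ , _ , inj₁ refl , inj₁ refl , r
  relatedEnds R (inj₁ (inj₂ r)) = _ , _ , inj₁ refl , inj₂ refl , r
  relatedEnds R (inj₂ (inj₁ r)) = _ , _ , inj₂ refl , inj₁ refl , r
  relatedEnds R (inj₂ (inj₂ r)) = _ , _ , inj₂ refl , inj₂ refl , r

  -- Disjointness and the absence of a joining edge form one pairwise relation, so that filtering,
  -- mapping and lookup treat both at once.
  Apart : Rel (V × V) 0ℓ
  Apart e f = ¬ ShareVertex G e f × ¬ JoinedByEdge G e f

  apart : ∀ {e f} → (∀ {x y} → x EndOf e → y EndOf f → x ≢ y × ¬ (x ~ y)) → Apart e f
  apart h =
    (λ s → let _ , _ , x∈ , y∈ , eq = relatedEnds _≡_ s in proj₁ (h x∈ y∈) eq) ,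
    (λ j → let _ , _ , x∈ , y∈ , r  = relatedEnds _~_ j in proj₂ (h x∈ y∈) r)

  apart-ends : ∀ {e f x y} → Apart e f → x EndOf e → y EndOf f → x ≢ y × ¬ (x ~ y)
  apart-ends (¬s , ¬j) x∈ y∈ = (¬s ∘ relate _≡_ x∈ y∈) , (¬j ∘ relate _~_ x∈ y∈)

  apart-sym : Symmetric Apart
  apart-sym ap = apart λ x∈ y∈ →
    let x≢y , ¬x~y = apart-ends ap y∈ x∈ in x≢y ∘ sym , ¬x~y ∘ ~-sym

  Induced : Pred (List (V × V)) 0ℓ
  Induced M = All (IsEdge G) M × AllPairs Apart M

  induced⇒isInducedMatching : ∀ {M} → Induced M → IsInducedMatching G M
  induced⇒isInducedMatching (edges , aparts) =
    let disjoint , unjoined = AllPairs.unzip aparts in (edges , disjoint) , unjoined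

  isInducedMatching⇒induced : ∀ {M} → IsInducedMatching G M → Induced M
  isInducedMatching⇒induced ((edges , disjoint) , unjoined) =
    edges , AllPairs.zip (disjoint , unjoined)

  induced-filter : ∀ {P : Pred (V × V) 0ℓ} (P? : Decidable P) {M} →
                   Induced M → Induced (filter P? M)
  induced-filter P? (edges , aparts) = All.filter⁺ P? edges , AllPairs.filter⁺ P? aparts

  length≤νᴵ : ∀ {M} → Induced M → length M ≤ νᴵ G
  length≤νᴵ {M} ind =
    proj₂ (proj₂ (maximumInducedMatching G)) (M , induced⇒isInducedMatching ind , refl)

  νᴵ-attained : ∃ λ M → Induced M × length M ≡ νᴵ G
  νᴵ-attained = let M , ind , eq = proj₁ (proj₂ (maximumInducedMatching G)) in
    M , isInducedMatching⇒induced ind , eq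

  β≤∣C∣ : ∀ {C} → IsVertexCover G C → β G ≤ ∣ C ∣
  β≤∣C∣ {C} cover = proj₂ (proj₂ (minimumVertexCover G)) (C , cover , refl)

  β-attained : ∃ λ C → IsVertexCover G C × ∣ C ∣ ≡ β G
  β-attained = proj₁ (proj₂ (minimumVertexCover G))

  -- The theorem splits on this for `FarFrom H v` and then `Misses H v`. Fixing the length makes the
  -- search finite, so the split is constructive.
  MaximumWithin : Pred (V × V) 0ℓ → Set
  MaximumWithin Q = ∃ λ M → (IsInducedMatching G M × All Q M) × length M ≡ νᴵ G

  maximumWithin? : ∀ {Q} → Decidable Q → Dec (MaximumWithin Q)
  maximumWithin? Q? =
    anyListOfLength? G (λ M → isInducedMatching? G M ×-dec all? Q? M) (νᴵ G)

  length<νᴵ : ∀ {Q M} → ¬ MaximumWithin Q → Induced M → All Q M → length M < νᴵ G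
  length<νᴵ {M = M} ¬max ind within = ℕ.≤∧≢⇒< (length≤νᴵ ind)
    λ eq → ¬max (M , (induced⇒isInducedMatching ind , within) , eq)

  Misses FarFrom : V → Pred (V × V) 0ℓ
  Misses  v e = ¬ (v EndOf e)
  -- (v , v) is a degenerate edge: e avoids the closed neighbourhood of v.
  FarFrom v e = Apart (v , v) e

  misses? : ∀ v → Decidable (Misses v)
  misses? v = ¬? ∘ endOf? v

  farFrom? : ∀ v → Decidable (FarFrom v)
  farFrom? v e =
    ¬? (endsRelated? G _≟_ (v , v) e) ×-dec ¬? (endsRelated? G _~?_ (v , v) e)

  -- Edges of a matching are disjoint, so at most one of them covers `v`.
  length≤1+filter-misses : ∀ v {M} → Induced M → length M ≤ suc (length (filter (misses? v) M))
  length≤1+filter-misses v (_ , aparts) = length≤1+filter-∁ (endOf? v)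
    (λ v∈e v∈f ap → proj₁ (apart-ends ap v∈e v∈f) refl) aparts

  -- Supplies the matching for the copies whose roots lie in a vertex cover.
  induced-missing : ∀ v → ∃ λ M → Induced M × All (Misses v) M × νᴵ G ≤ suc (length M)
  induced-missing v =
    let M , ind , eq = νᴵ-attained in
    filter (misses? v) M , induced-filter (misses? v) ind , All.all-filter (misses? v) M ,
    ℕ.≤-trans (ℕ.≤-reflexive (sym eq)) (length≤1+filter-misses v ind)

-- Transport of induced matchings along embeddings onto induced subgraphs.

module Embedding (G K : Graph) (φ : Graph.V G → Graph.V K)
                 (φ-injective : Injective _≡_ _≡_ φ)
                 (φ-edge : ∀ {x y} → Graph._~_ G x y → Graph._~_ K (φ x) (φ y))
                 (edge-φ : ∀ {x y} → Graph._~_ K (φ x) (φ y) → Graph._~_ G x y) where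

  mapEdge : Graph.V G × Graph.V G → Graph.V K × Graph.V K
  mapEdge (x , y) = φ x , φ y

  endOf-map⁺ : ∀ {x e} → x EndOf e → φ x EndOf mapEdge e
  endOf-map⁺ = Sum.map (cong φ) (cong φ)

  endOf-map⁻ : ∀ {p e} → p EndOf mapEdge e → ∃ λ x → p ≡ φ x × x EndOf e
  endOf-map⁻ (inj₁ eq) = _ , eq , inj₁ refl
  endOf-map⁻ (inj₂ eq) = _ , eq , inj₂ refl

  apart⁺ : ∀ {e f} → Apart G e f → Apart K (mapEdge e) (mapEdge f)
  apart⁺ ap = apart K λ p∈ q∈ → case-ends (endOf-map⁻ p∈) (endOf-map⁻ q∈)
    where
    case-ends : ∀ {p q} → (∃ λ x → p ≡ φ x × x EndOf _) → (∃ λ y → q ≡ φ y × y EndOf _) →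
                p ≢ q × ¬ (Graph._~_ K p q)
    case-ends (_ , refl , x∈) (_ , refl , y∈) =
      let x≢y , ¬x~y = apart-ends G ap x∈ y∈ in x≢y ∘ φ-injective , ¬x~y ∘ edge-φ

  apart⁻ : ∀ {e f} → Apart K (mapEdge e) (mapEdge f) → Apart G e f
  apart⁻ ap = apart G λ x∈ y∈ →
    let φx≢φy , ¬φx~φy = apart-ends K ap (endOf-map⁺ x∈) (endOf-map⁺ y∈) in
    φx≢φy ∘ cong φ , ¬φx~φy ∘ φ-edge

  -- This direction builds matchings of the product; `induced⁻` bounds those lying in one copy or on
  -- the roots.
  induced⁺ : ∀ {M} → Induced G M → Induced K (map mapEdge M)
  induced⁺ (edges , aparts) =
    All.map⁺ (All.map φ-edge edges) , AllPairs.map⁺ (AllPairs.map apart⁺ aparts)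

  induced⁻ : ∀ {M} → Induced K (map mapEdge M) → Induced G M
  induced⁻ (edges , aparts) =
    All.map edge-φ (All.map⁻ edges) , AllPairs.map apart⁻ (AllPairs.map⁻ aparts)

-- Matchings of the rooted product assembled from its copies of `H`.

module _ (G H : Graph) (v : Graph.V H) where
  private
    module G = Graph G
    module H = Graph H
    K = rootedProduct G H v
    module K = Graph K

    copy-edge⁻ : ∀ {x h k} → (x , h) K.~ (x , k) → h H.~ k
    copy-edge⁻ (inj₁ (_ , e))     = e
    copy-edge⁻ (inj₂ (e , _ , _)) = contradiction e (G.~-irrefl refl)

    root-edge⁻ : ∀ {x y} → (x , v) K.~ (y , v) → x G.~ y
    root-edge⁻ (inj₁ (_ , e))     = contradiction e (H.~-irrefl refl)
    root-edge⁻ (inj₂ (e , _ , _)) = e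

    module Copy (x : G.V) =
      Embedding H K (x ,_) (cong proj₂) (λ e → inj₁ (refl , e)) copy-edge⁻
    module Roots =
      Embedding G K (_, v) (cong proj₁) (λ e → inj₂ (e , refl , refl)) root-edge⁻

  copies : (Fin G.order → List (H.V × H.V)) → List (K.V × K.V)
  copies f = concat (tabulate λ i → map (Copy.mapEdge (G.vertex i)) (f i))

  length-copies : ∀ f → length (copies f) ≡ sum (length ∘ f)
  length-copies f = trans
    (length-concat-tabulate (λ i → map (Copy.mapEdge (G.vertex i)) (f i)))
    (sum-cong-≗ (λ i → length-map (Copy.mapEdge (G.vertex i)) (f i)))

  -- Distinct copies are joined only root to root, along edges of `G`, so one of the two edges
  -- missing `v` is enough.
  copies-apart : ∀ {x y e f} → x ≢ y → (x G.~ y → Misses H v e ⊎ Misses H v f) →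
                 Apart K (Copy.mapEdge x e) (Copy.mapEdge y f)
  copies-apart {x} {y} {e} {f} x≢y miss = apart K λ p∈ q∈ →
    let _ , p≡ , h∈ = Copy.endOf-map⁻ x p∈
        _ , q≡ , k∈ = Copy.endOf-map⁻ y q∈
    in (λ p≡q → x≢y (cong proj₁ (trans (sym p≡) (trans p≡q q≡)))) ,
       (λ p~q → unjoined h∈ k∈ (subst₂ K._~_ p≡ q≡ p~q))
    where
    unjoined : ∀ {h k} → h EndOf e → k EndOf f → ¬ ((x , h) K.~ (y , k))
    unjoined h∈ k∈ (inj₁ (x≡y , _))         = x≢y x≡y
    unjoined h∈ k∈ (inj₂ (x~y , refl , refl)) with miss x~y
    ... | inj₁ v∉e = v∉e h∈
    ... | inj₂ v∉f = v∉f k∈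

  -- A vertex `(z , k)` can equal or be adjacent to a root only if `k` is `v` or, within the same
  -- copy, a neighbour of `v`. `FarFrom` excludes both.
  root-copy-apart : ∀ {z e f} → FarFrom H v f → Apart K (Roots.mapEdge e) (Copy.mapEdge z f)
  root-copy-apart {z} {e} {f} far = apart K λ p∈ q∈ →
    let _ , p≡ , x∈ = Roots.endOf-map⁻ p∈
        _ , q≡ , k∈ = Copy.endOf-map⁻ z q∈
        v≢k , ¬v~k  = apart-ends H far (inj₁ refl) k∈
    in (λ p≡q → v≢k (cong proj₂ (trans (sym p≡) (trans p≡q q≡)))) ,
       (λ p~q → unjoined v≢k ¬v~k (subst₂ K._~_ p≡ q≡ p~q))
    where
    unjoined : ∀ {x k} → v ≢ k → ¬ (v H.~ k) → ¬ ((x , v) K.~ (z , k))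
    unjoined v≢k ¬v~k (inj₁ (_ , v~k))     = ¬v~k v~k
    unjoined v≢k ¬v~k (inj₂ (_ , _ , k≡v)) = v≢k (sym k≡v)

  -- The matching may vary with the copy, so that copies over a vertex cover can use a smaller one.
  copies-induced : (f : Fin G.order → List (H.V × H.V)) → (∀ i → Induced H (f i)) →
    (∀ i j → G.vertex i G.~ G.vertex j → All (Misses H v) (f i) ⊎ All (Misses H v) (f j)) →
    Induced K (copies f)
  copies-induced f ind miss =
    All.concat⁺ (All.tabulate⁺ λ i → proj₁ (copy i)) ,
    AllPairs.concat⁺ (All.tabulate⁺ λ i → proj₂ (copy i)) (AllPairs.tabulate⁺ cross)
    where
    copy : ∀ i → Induced K (map (Copy.mapEdge (G.vertex i)) (f i))
    copy i = Copy.induced⁺ (G.vertex i) (ind i)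
    cross : ∀ {i j} → i ≢ j →
      All (λ e → All (Apart K e) (map (Copy.mapEdge (G.vertex j)) (f j)))
          (map (Copy.mapEdge (G.vertex i)) (f i))
    cross {i} {j} i≢j = All.map⁺ (All.tabulate λ e∈ → All.map⁺ (All.tabulate λ f∈ →
      copies-apart (i≢j ∘ vertex-injective) λ i~j →
        Sum.map (λ m → All.lookup m e∈) (λ m → All.lookup m f∈) (miss i j i~j)))
      where
      vertex-injective : G.vertex i ≡ G.vertex j → i ≡ j
      vertex-injective eq = trans (sym (Inverse.strictlyInverseˡ G.enumeration i))
        (trans (cong G.index eq) (Inverse.strictlyInverseˡ G.enumeration j))

  -- Edges inside copies and bridges between them.

  -- A bridge is assigned to the copy of its first listed end, so every edge is counted in exactly
  -- one group.
  source : K.V × K.V → G.V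
  source e = proj₁ (proj₁ e)

  Inner : Pred (K.V × K.V) 0ℓ
  Inner ((x , _) , (y , _)) = x ≡ y

  inner? : Decidable Inner
  inner? ((x , _) , (y , _)) = x G.≟ y

  InCopy : G.V → Pred (K.V × K.V) 0ℓ
  InCopy x e = ∃ λ e′ → e ≡ Copy.mapEdge x e′

  inner⇒inCopy : ∀ {x e} → source e ≡ x → Inner e → InCopy x e
  inner⇒inCopy {e = (_ , h) , (_ , k)} refl refl = (h , k) , refl

  -- A bridge listed from copy `x` starts at the root of that copy.
  misses⇒inCopy : ∀ {x e} → source e ≡ x → IsEdge K e → Misses K (x , v) e → InCopy x e
  misses⇒inCopy refl (inj₁ (refl , _))     _    = _ , refl
  misses⇒inCopy refl (inj₂ (_ , refl , _)) root∉ = contradiction (inj₁ refl) root∉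

  bridge⇒root : ∀ {e} → IsEdge K e → ¬ Inner e → ∃ λ e′ → e ≡ Roots.mapEdge e′
  bridge⇒root (inj₁ (x≡y , _))         ¬inner = contradiction x≡y ¬inner
  bridge⇒root (inj₂ (_ , refl , refl)) _      = _ , refl

  -- Size of the group of edges starting in one copy.

  module _ {x : G.V} {L : List (K.V × K.V)} (ind : Induced K L) where

    length-inCopy≤νᴵ : All (InCopy x) L → length L ≤ νᴵ H
    length-inCopy≤νᴵ copy with all-image copy
    ... | N , refl = subst (_≤ νᴵ H) (sym (length-map (Copy.mapEdge x) N))
                       (length≤νᴵ H (Copy.induced⁻ x ind))

    length-inCopy<νᴵ : ∀ {Q} → ¬ MaximumWithin H Q → All (InCopy x) L →
      (∀ {e} → Copy.mapEdge x e ∈ L → Q e) → length L < νᴵ H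
    length-inCopy<νᴵ ¬max copy within with all-image copy
    ... | N , refl = subst (_< νᴵ H) (sym (length-map (Copy.mapEdge x) N))
                       (length<νᴵ H ¬max (Copy.induced⁻ x ind)
                         (All.tabulate (within ∘ ∈-map⁺ (Copy.mapEdge x))))

  module _ {x : G.V} {L : List (K.V × K.V)}
           (ind : Induced K L) (starts : All (λ e → source e ≡ x) L) where

    rootMissed⇒inCopy : ∀ {e} → e ∈ L → Misses K (x , v) e → InCopy x e
    rootMissed⇒inCopy e∈ = misses⇒inCopy (All.lookup starts e∈) (All.lookup (proj₁ ind) e∈)

    -- An edge at the root keeps every other edge of L away from the closed
    -- neighbourhood of v, whether it lies in the copy or leaves it.
    rootCovered⇒length≤νᴵ : ¬ MaximumWithin H (FarFrom H v) →
      Any ((x , v) EndOf_) L → length L ≤ νᴵ H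
    rootCovered⇒length≤νᴵ ¬far any =
      -- Without the edge at the root, the group is far from `v` and hence has fewer than `νᴵ H`
      -- edges; this strictness absorbs the removed edge.
      ℕ.≤-trans (length≤1+filter-misses K (x , v) ind)
        (length-inCopy<νᴵ (induced-filter K miss? ind) ¬far
          (All.tabulate λ e∈ → let e∈L , root∉ = ∈-filter⁻ miss? e∈ in
            rootMissed⇒inCopy e∈L root∉)
          far)
      where
      miss? = misses? K (x , v)
      b∈ = proj₁ (proj₂ (find any))
      root∈b = proj₂ (proj₂ (find any))
      far : ∀ {e} → Copy.mapEdge x e ∈ filter miss? L → FarFrom H v e
      far {e} e∈ = apart H λ w∈ h∈ → let
          e∈L , root∉ = ∈-filter⁻ miss? e∈
          ap = allPairs-lookup (apart-sym K) (proj₂ ind) b∈ e∈L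
                 (λ eq → root∉ (subst ((x , v) EndOf_) eq root∈b))
          r≢h , ¬r~h = apart-ends K ap root∈b (Copy.endOf-map⁺ x h∈)
          -- Both ends of the degenerate edge `(v , v)` are `v`.
          w≡v = Sum.reduce w∈
        in (λ w≡h → r≢h (cong (x ,_) (trans (sym w≡v) w≡h))) ,
           (λ w~h → ¬r~h (inj₁ (refl , subst (H._~ _) w≡v w~h)))

    rootMissed⇒All-inCopy : ¬ Any ((x , v) EndOf_) L → All (InCopy x) L
    rootMissed⇒All-inCopy ¬any = All.tabulate λ e∈ →
      rootMissed⇒inCopy e∈ λ r∈e → ¬any (lose e∈ r∈e)

    starts⇒length≤νᴵ : ¬ MaximumWithin H (FarFrom H v) → length L ≤ νᴵ H
    starts⇒length≤νᴵ ¬far with any? (endOf? K (x , v)) L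
    ... | yes any = rootCovered⇒length≤νᴵ ¬far any
    ... | no ¬any = length-inCopy≤νᴵ ind (rootMissed⇒All-inCopy ¬any)

    -- A group that misses the root lies inside the copy and pulls back to a matching missing `v`,
    -- which is too short to be full.
    full⇒rootCovered : ¬ MaximumWithin H (Misses H v) → ¬ (length L < νᴵ H) →
                       Any ((x , v) EndOf_) L
    full⇒rootCovered ¬miss full with any? (endOf? K (x , v)) L
    ... | yes any = any
    ... | no ¬any = contradiction
      (length-inCopy<νᴵ ind ¬miss (rootMissed⇒All-inCopy ¬any)
        (λ e∈ v∈e → ¬any (lose e∈ (Copy.endOf-map⁺ x v∈e))))
      full

  -- Upper bounds by summing over the groups.

  fibreAt : Fin G.order → List (K.V × K.V) → List (K.V × K.V)
  fibreAt = fibre (G.index ∘ source)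

  fibreAt-starts : ∀ x M → All (λ e → source e ≡ x) (fibreAt (G.index x) M)
  fibreAt-starts x M = All.map G.index-injective (All.all-filter _ M)

  module _ {M} (ind : Induced K M) where

    fibreAt-induced : ∀ i → Induced K (fibreAt i M)
    fibreAt-induced i = induced-filter K _ ind

    fibreAt-length≤νᴵ : ¬ MaximumWithin H (FarFrom H v) →
                        ∀ i → length (fibreAt i M) ≤ νᴵ H
    fibreAt-length≤νᴵ ¬far i = subst (λ j → length (fibreAt j M) ≤ νᴵ H)
      (Inverse.strictlyInverseˡ G.enumeration i)
      (starts⇒length≤νᴵ (fibreAt-induced _) (fibreAt-starts (G.vertex i) M) ¬far)

    notFar⇒length≤ : ¬ MaximumWithin H (FarFrom H v) → length M ≤ G.order * νᴵ H
    notFar⇒length≤ ¬far =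
      ℕ.≤-trans (length≤sum-fibres (G.index ∘ source) M) (sum≤n*m (fibreAt-length≤νᴵ ¬far))

    all-inner⇒length≤ : All Inner M → length M ≤ G.order * νᴵ H
    all-inner⇒length≤ inner =
      ℕ.≤-trans (length≤sum-fibres (G.index ∘ source) M) (sum≤n*m λ i →
        length-inCopy≤νᴵ {x = G.vertex i} (fibreAt-induced i) (All.tabulate λ e∈ →
          let e∈M , eq = ∈-filter⁻ (λ e → G.index (source e) Fin.≟ i) e∈ in
          inner⇒inCopy
            (G.index-injective (trans eq (sym (Inverse.strictlyInverseˡ G.enumeration i))))
            (All.lookup inner e∈M)))

    all-bridges⇒length≤νᴵ : All (∁ Inner) M → length M ≤ νᴵ G
    all-bridges⇒length≤νᴵ bridges
      with all-image (All.zipWith (λ (e , b) → bridge⇒root e b) (proj₁ ind , bridges))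
    ... | N , refl = subst (_≤ νᴵ G) (sym (length-map Roots.mapEdge N))
                       (length≤νᴵ G (Roots.induced⁻ ind))

    nonFull : Subset G.order
    nonFull = Vec.tabulate λ i → does (length (fibreAt i M) ℕ.<? νᴵ H)

    ∈-nonFull : ∀ {i} → length (fibreAt i M) < νᴵ H → i ∈ₛ nonFull
    ∈-nonFull {i} l< =
      lookup⇒[]= i nonFull (trans (lookup∘tabulate _ i) (dec-true (_ ℕ.<? _) l<))

    -- Full groups at adjacent vertices would each contain an edge at their root. These edges have
    -- different sources, so they are distinct, yet the edge between the two roots joins them.
    nonFull-cover : ¬ MaximumWithin H (Misses H v) → IsVertexCover G nonFull
    nonFull-cover ¬miss x y x~y
      with length (fibreAt (G.index x) M) ℕ.<? νᴵ H | length (fibreAt (G.index y) M) ℕ.<? νᴵ H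
    ... | yes x< | _    = inj₁ (∈-nonFull x<)
    ... | no _ | yes y< = inj₂ (∈-nonFull y<)
    ... | no x≮ | no y≮ =
      let e , e∈ , root∈e , source-e = rootEdge x≮
          f , f∈ , root∈f , source-f = rootEdge y≮
          e≢f = λ e≡f → G.~-irrefl (trans (sym source-e) (trans (cong source e≡f) source-f)) x~y
          ap  = allPairs-lookup (apart-sym K) (proj₂ ind) e∈ f∈ e≢f
      in contradiction (inj₂ (x~y , refl , refl)) (proj₂ (apart-ends K ap root∈e root∈f))
      where
      rootEdge : ∀ {z} → ¬ (length (fibreAt (G.index z) M) < νᴵ H) →
                 ∃ λ e → e ∈ M × (z , v) EndOf e × source e ≡ z
      rootEdge {z} full =
        let e , e∈ , root∈e = find (full⇒rootCovered (fibreAt-induced (G.index z))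
                                (fibreAt-starts z M) ¬miss full)
            e∈M , eq = ∈-filter⁻ (λ e → G.index (source e) Fin.≟ G.index z) e∈
        in e , e∈M , root∈e , G.index-injective eq

    -- Each group, plus one if it is not full, is at most `νᴵ H`; the added ones count a vertex
    -- cover.
    notFar⇒length+β≤ : ¬ MaximumWithin H (FarFrom H v) → ¬ MaximumWithin H (Misses H v) →
                       length M + β G ≤ G.order * νᴵ H
    notFar⇒length+β≤ ¬far ¬miss = begin
      length M + β G
        ≤⟨ ℕ.+-mono-≤ (length≤sum-fibres (G.index ∘ source) M) (β≤∣C∣ G (nonFull-cover ¬miss)) ⟩
      sum (λ i → length (fibreAt i M)) + ∣ nonFull ∣
        ≡⟨ cong (_+_ _) (∣∣≡sum-indicator nonFull) ⟩
      sum (λ i → length (fibreAt i M)) + sum (indicator ∘ Vec.lookup nonFull)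
        ≡⟨ ∑-distrib-+ (λ i → length (fibreAt i M)) (indicator ∘ Vec.lookup nonFull) ⟨
      sum (λ i → length (fibreAt i M) + indicator (Vec.lookup nonFull i))
        ≤⟨ sum≤n*m bound ⟩
      G.order * νᴵ H ∎
      where
      open ℕ.≤-Reasoning
      bound : ∀ i → length (fibreAt i M) + indicator (Vec.lookup nonFull i) ≤ νᴵ H
      bound i rewrite lookup∘tabulate (λ i → does (length (fibreAt i M) ℕ.<? νᴵ H)) i =
        +-indicator-≤ (_ ℕ.<? _) (fibreAt-length≤νᴵ ¬far i)

  -- Inner edges are bounded copy by copy, while the bridges pull back to an induced matching of
  -- `G`.
  length≤sum : ∀ {M} → Induced K M → length M ≤ G.order * νᴵ H + νᴵ G
  length≤sum {M} ind = subst (_≤ G.order * νᴵ H + νᴵ G) (sym (length-filter+filter-∁ inner? M))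
    (ℕ.+-mono-≤
      (all-inner⇒length≤ (induced-filter K inner? ind) (All.all-filter inner? M))
      (all-bridges⇒length≤νᴵ (induced-filter K (¬? ∘ inner?) ind)
        (All.all-filter (¬? ∘ inner?) M)))

  -- Lower bounds by construction.

  far⇒≤νᴵ : MaximumWithin H (FarFrom H v) → G.order * νᴵ H + νᴵ G ≤ νᴵ K
  far⇒≤νᴵ (N , (isInd , far) , eq) =
    let B , ind-B , length-B = νᴵ-attained G
        edges , aparts = Roots.induced⁺ ind-B
        f = λ (_ : Fin G.order) → N
        edges′ , aparts′ = copies-induced f (λ _ → isInducedMatching⇒induced H isInd)
          -- Far from `v` includes missing `v`, so copies at adjacent vertices do not interfere.
          (λ _ _ _ → inj₁ (All.map (λ ap v∈ → proj₁ (apart-ends H ap (inj₁ refl) v∈) refl) far))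
        crossing = All.map⁺ (All.tabulate λ {e} _ → All.concat⁺ (All.tabulate⁺ λ i →
          All.map⁺ (All.map (root-copy-apart {G.vertex i} {e}) far)))
        ind = All.++⁺ edges edges′ , AllPairs.++⁺ aparts aparts′ crossing
    in begin
      G.order * νᴵ H + νᴵ G             ≡⟨ ℕ.+-comm (G.order * νᴵ H) _ ⟩
      νᴵ G + G.order * νᴵ H
        ≡⟨ cong₂ _+_ (sym (trans (length-map Roots.mapEdge B) length-B))
             (sym (trans (length-copies f) (trans (sum-const G.order _) (cong (_*_ G.order) eq)))) ⟩
      length (map Roots.mapEdge B) + length (copies f)  ≡⟨ length-++ (map Roots.mapEdge B) ⟨
      length (map Roots.mapEdge B ++ copies f)          ≤⟨ length≤νᴵ K ind ⟩
      νᴵ K                              ∎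
    where open ℕ.≤-Reasoning

  miss⇒≤νᴵ : MaximumWithin H (Misses H v) → G.order * νᴵ H ≤ νᴵ K
  miss⇒≤νᴵ (N , (isInd , miss) , eq) =
    let f = λ (_ : Fin G.order) → N
        ind = copies-induced f (λ _ → isInducedMatching⇒induced H isInd) (λ _ _ _ → inj₁ miss)
    in subst (_≤ νᴵ K)
         (trans (length-copies f) (trans (sum-const G.order _) (cong (_*_ G.order) eq)))
         (length≤νᴵ K ind)

  -- Over a minimum cover the copies use a matching that misses `v`, losing at most one edge each;
  -- every edge of `G` has an end in such a copy. Adding `β G` on the right avoids truncated
  -- subtraction.
  ≤νᴵ+β : G.order * νᴵ H ≤ νᴵ K + β G
  ≤νᴵ+β with νᴵ-attained H | induced-missing H v | β-attained G
  ... | N , ind-N , length-N | N′ , ind-N′ , miss , length-N′ | C , cover , ∣C∣≡β = begin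
    G.order * νᴵ H                                             ≤⟨ n*m≤sum bound ⟩
    sum (λ i → length (f i) + indicator (Vec.lookup C i))
      ≡⟨ ∑-distrib-+ (length ∘ f) (indicator ∘ Vec.lookup C) ⟩
    sum (length ∘ f) + sum (indicator ∘ Vec.lookup C)
      ≡⟨ cong₂ _+_ (sym (length-copies f)) (trans (sym (∣∣≡sum-indicator C)) ∣C∣≡β) ⟩
    length (copies f) + β G
      ≤⟨ ℕ.+-monoˡ-≤ (β G) (length≤νᴵ K (copies-induced f f-induced f-misses)) ⟩
    νᴵ K + β G                                                 ∎
    where
    open ℕ.≤-Reasoning
    f : Fin G.order → List (H.V × H.V)
    f i = if Vec.lookup C i then N′ else N
    bound : ∀ i → νᴵ H ≤ length (f i) + indicator (Vec.lookup C i)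
    bound i with Vec.lookup C i
    ... | true  = subst (νᴵ H ≤_) (ℕ.+-comm 1 _) length-N′
    ... | false = ℕ.≤-reflexive (trans (sym length-N) (sym (ℕ.+-identityʳ _)))
    f-induced : ∀ i → Induced H (f i)
    f-induced i with Vec.lookup C i
    ... | true  = ind-N′
    ... | false = ind-N
    covered : ∀ i → G.index (G.vertex i) ∈ₛ C → All (Misses H v) (f i)
    covered i i∈
      -- Membership turns `Vec.lookup C i` into `true`, so `f i` reduces to `N′`.
      rewrite []=⇒lookup (subst (_∈ₛ C) (Inverse.strictlyInverseˡ G.enumeration i) i∈) = miss
    f-misses : ∀ i j → G.vertex i G.~ G.vertex j →
               All (Misses H v) (f i) ⊎ All (Misses H v) (f j)
    f-misses i j i~j = Sum.map (covered i) (covered j) (cover _ _ i~j)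

theorem6p1 : (G H : Graph) (v : Graph.V H) →
    let n = Graph.order G in
    + νᴵ (rootedProduct G H v) ∈
    (+ (n * νᴵ H) - + β G) ∷ + (n * νᴵ H) ∷ + (n * νᴵ H + νᴵ G) ∷ []
theorem6p1 G H v
  with νᴵ-attained (rootedProduct G H v)
     | maximumWithin? H (farFrom? H v) | maximumWithin? H (misses? H v)
... | M , ind , eq | yes far | _ =
  there (there (here (cong +_ (ℕ.≤-antisym
    (subst (_≤ _) eq (length≤sum G H v ind)) (far⇒≤νᴵ G H v far)))))
... | M , ind , eq | no ¬far | yes miss =
  there (here (cong +_ (ℕ.≤-antisym
    (subst (_≤ _) eq (notFar⇒length≤ G H v ind ¬far)) (miss⇒≤νᴵ G H v miss))))
... | M , ind , eq | no ¬far | no ¬miss = here (ℤ-difference (ℕ.≤-antisym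
    (subst (λ k → k + β G ≤ _) eq (notFar⇒length+β≤ G H v ind ¬far ¬miss)) (≤νᴵ+β G H v)))
  where
  -- Carries the additive equation over the naturals to the integer difference of the statement.
  ℤ-difference : ∀ {k b m} → k + b ≡ m → + k ≡ + m - + b
  ℤ-difference {k} {b} refl = begin
    + k                       ≡⟨ ℤ.+-identityʳ (+ k) ⟨
    + k ℤ.+ + 0               ≡⟨ cong (ℤ._+_ (+ k)) (ℤ.+-inverseʳ (+ b)) ⟨
    + k ℤ.+ (+ b - + b)       ≡⟨ ℤ.+-assoc (+ k) (+ b) (ℤ.- + b) ⟨
    + (k + b) - + b           ∎
    where open ≡-Reasoning
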